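{- Let $G$ be a finite graph and let $G_{\text{R-core}}$ be the R-core of $G$. Then $G_{\text{R-core}}$ is isomorphic to an induced subgraph of $G$.
   Context: Graphs are finite and undirected, loops allowed. For a finite set $B$ and a relation $R\subseteq V_G\times B$ with full image (every $b\in B$ has some $v$ with $(v,b)\in R$), $G\ast R$ is the graph with vertex set $B$ and edge set $\{(a,b)\in B\times B: \exists (u,v)\in E_G,\ (u,a)\in R,\ (v,b)\in R\}$. All relations here are required to have full domain (every $v\in V_G$ is related to some $b\in B$). $G$ and $H$ are weakly relationally equivalent if there are relations $R\subseteq V_G\times V_H$ and $S\subseteq V_H\times V_G$ with $G\ast R=H$ and $H\ast S=G$; this is an equivalence relation. A graph is an R-core if it has the minimum number of vertices among all graphs in its weak relational equivalence class. An R-core of $G$ is an R-core weakly relationally equivalent to $G$; it is unique up to isomorphism and denoted $G_{\text{R-core}}$. -}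

module Defs where

open import Data.Fin using (Fin)
open import Data.Fin.Properties using (any?)
open import Data.Fin.Subset using (Subset; _∈_)
open import Data.Nat using (ℕ; _≤_)
open import Data.Product using (Σ-syntax; ∃-syntax; _×_; _,_; proj₁)
open import Function.Bundles using (_↔_; Inverse) renaming (_⇔_ to _iff_)
open import Level using (0ℓ)
open import Relation.Binary using (Rel; REL; Symmetric; Decidable; _⇔_)
open import Relation.Nullary.Decidable using (_×-dec_)

-- Loops are allowed, so irreflexivity is not assumed.  Decidability is
-- automatic classically; here it says that the edge set is a subset in
-- the sense usual for finite sets.
record Graph (V : Set) : Set₁ where
  field
    Edge  : Rel V 0ℓ
    sym   : Symmetric Edge
    edge? : Decidable Edge

open Graph public using (Edge)

FinGraph : ℕ → Set₁
FinGraph n = Graph (Fin n)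

record FullRelation (A B : Set) : Set₁ where
  field
    Related    : REL A B 0ℓ
    related?   : Decidable Related
    fullDomain : ∀ a → ∃[ b ] Related a b
    fullImage  : ∀ b → ∃[ a ] Related a b

open FullRelation public using (Related)

infixl 7 _∗_

_∗_ : ∀ {n} {B : Set} → FinGraph n → FullRelation (Fin n) B → Graph B
G ∗ R = record
  { Edge  = λ a b → ∃[ u ] ∃[ v ] (Edge G u v × Related R u a × Related R v b)
  ; sym   = λ (u , v , uv , ua , vb) → v , u , Graph.sym G uv , vb , ua
  ; edge? = λ a b → any? λ u → any? λ v →
      Graph.edge? G u v ×-dec R.related? u a ×-dec R.related? v b
  }
  where module R = FullRelation R

-- Equality of graphs on a common vertex set: the edge sets coincide.
infix 4 _≐_

_≐_ : ∀ {V} → Graph V → Graph V → Set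
G ≐ H = Edge G ⇔ Edge H

WeaklyRelEquivalent : ∀ {m n} → FinGraph m → FinGraph n → Set₁
WeaklyRelEquivalent {m} {n} G H =
  (Σ[ R ∈ FullRelation (Fin m) (Fin n) ] G ∗ R ≐ H) ×
  (Σ[ S ∈ FullRelation (Fin n) (Fin m) ] H ∗ S ≐ G)

IsRCore : ∀ {n} → FinGraph n → Set₁
IsRCore {n} G = ∀ {m} (K : FinGraph m) → WeaklyRelEquivalent G K → n ≤ m

IsRCoreOf : ∀ {m n} → FinGraph m → FinGraph n → Set₁
IsRCoreOf C G = IsRCore C × WeaklyRelEquivalent C G

induced : ∀ {n} → FinGraph n → (W : Subset n) → Graph (∃[ v ] v ∈ W)
induced G W = record
  { Edge  = λ u v → Edge G (proj₁ u) (proj₁ v)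
  ; sym   = Graph.sym G
  ; edge? = λ u v → Graph.edge? G (proj₁ u) (proj₁ v)
  }

infix 4 _≅_

record _≅_ {V W : Set} (G : Graph V) (H : Graph W) : Set where
  field
    vertices : V ↔ W

  open Inverse vertices public using (to; from)

  field
    edges : ∀ u v → Edge G u v iff Edge H (to u) (to v)

{-# OPTIONS --safe #-}
-- Composing the relations C → G → C gives a relation T with C ∗ T = C.  If some set A of vertices
-- had fewer than ∣ A ∣ T-neighbours, T would factor through the smaller set ∁ A ⊎ T(A), which
-- contradicts the minimality of C; so by Hall's theorem T contains a permutation π.  Let f u be a
-- vertex of G through which u is T-related to π u.  An edge of C between u and v gives an edge of G
-- between f u and f v, which gives an edge of C between π u and π v; as π has finite order, all
-- three are equivalent.  Finally f is injective: if f u = f v then u and v have the same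
-- neighbours, and merging them would again contradict minimality.
module Submission where

open import Data.Fin
  using (Fin; zero; suc; _≟_; toℕ; combine; remQuot; splitAt; _↑ˡ_; _↑ʳ_; punchIn; punchOut)
open import Data.Fin.Properties
  using (any?; all?; combine-injective; remQuot-combine; combine-remQuot; splitAt-↑ˡ; splitAt-↑ʳ;
         punchIn-punchOut; pigeonhole)
open import Data.Fin.Subset
open import Data.Fin.Subset.Induction using (⊂-wellFounded)
open import Data.Fin.Subset.Properties
open import Data.Nat using (ℕ; zero; suc; _+_; _*_; _≤_; _<_; _≤?_; s≤s)
import Data.Nat.Properties as ℕ
open import Data.Nat.GeneralisedArithmetic using (fold)
open import Data.Product using (Σ-syntax; ∃; ∃-syntax; _×_; _,_; proj₁; proj₂; uncurry)
open import Data.Sum using (_⊎_; inj₁; inj₂)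
open import Data.Vec using ([]; _∷_; tabulate; here; there)
open import Data.Vec.Properties using ([]=⇒lookup; lookup⇒[]=; lookup∘tabulate)
open import Data.Vec.Properties.WithK using ([]=-irrelevant)
open import Defs
open import Function using (_∘_; id; flip)
open import Function.Bundles using (mk↔ₛ′; mk⇔)
open import Function.Definitions using (Injective)
open import Induction.WellFounded using (Acc; acc)
open import Level using (0ℓ)
open import Relation.Binary using (Rel; REL; Decidable; _⇔_)
open import Relation.Binary.PropositionalEquality
  using (_≡_; _≢_; refl; sym; trans; cong; cong₂; subst)
open import Relation.Nullary using (¬_; Dec; yes; no; does; contradiction; decidable-stable)
open import Relation.Nullary.Decidable using (_×-dec_; _→-dec_; ¬?; dec-true)
open import Relation.Unary using (Pred) renaming (Decidable to Decidable₁)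

private
  variable
    k m n : ℕ

-- Finite subsets

comprehension : {P : Pred (Fin n) 0ℓ} → Decidable₁ P → Subset n
comprehension P? = tabulate (does ∘ P?)

∈-comprehension⁺ : {P : Pred (Fin n) 0ℓ} (P? : Decidable₁ P) → ∀ {x} → P x → x ∈ comprehension P?
∈-comprehension⁺ P? {x} px =
  lookup⇒[]= x _ (trans (lookup∘tabulate (does ∘ P?) x) (dec-true (P? x) px))

∈-comprehension⁻ : {P : Pred (Fin n) 0ℓ} (P? : Decidable₁ P) → ∀ {x} → x ∈ comprehension P? → P x
∈-comprehension⁻ P? {x} x∈ with P? x | trans (sym (lookup∘tabulate (does ∘ P?) x)) ([]=⇒lookup x∈)
... | yes px | _  = px
... | no  _  | ()

x∉p-x : ∀ (p : Subset n) x → x ∉ p - x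
x∉p-x (_ ∷ _) zero    ()
x∉p-x (_ ∷ p) (suc x) (there x∈) = x∉p-x p x x∈

∣p∣≤1+∣p-x∣ : ∀ (p : Subset n) x → ∣ p ∣ ≤ suc ∣ p - x ∣
∣p∣≤1+∣p-x∣ (outside ∷ p) zero    = ℕ.m≤n⇒m≤1+n (ℕ.≤-reflexive (cong ∣_∣ (sym (p─⊥≡p p))))
∣p∣≤1+∣p-x∣ (inside  ∷ p) zero    = s≤s (ℕ.≤-reflexive (cong ∣_∣ (sym (p─⊥≡p p))))
∣p∣≤1+∣p-x∣ (outside ∷ p) (suc x) = ∣p∣≤1+∣p-x∣ p x
∣p∣≤1+∣p-x∣ (inside  ∷ p) (suc x) = s≤s (∣p∣≤1+∣p-x∣ p x)

∣p∪q∣+∣p∩q∣≡∣p∣+∣q∣ : ∀ (p q : Subset n) → ∣ p ∪ q ∣ + ∣ p ∩ q ∣ ≡ ∣ p ∣ + ∣ q ∣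
∣p∪q∣+∣p∩q∣≡∣p∣+∣q∣ []            []            = refl
∣p∪q∣+∣p∩q∣≡∣p∣+∣q∣ (outside ∷ p) (outside ∷ q) = ∣p∪q∣+∣p∩q∣≡∣p∣+∣q∣ p q
∣p∪q∣+∣p∩q∣≡∣p∣+∣q∣ (inside  ∷ p) (outside ∷ q) = cong suc (∣p∪q∣+∣p∩q∣≡∣p∣+∣q∣ p q)
∣p∪q∣+∣p∩q∣≡∣p∣+∣q∣ (outside ∷ p) (inside  ∷ q) =
  trans (cong suc (∣p∪q∣+∣p∩q∣≡∣p∣+∣q∣ p q)) (sym (ℕ.+-suc ∣ p ∣ ∣ q ∣))
∣p∪q∣+∣p∩q∣≡∣p∣+∣q∣ (inside  ∷ p) (inside  ∷ q) = cong suc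
  (trans (ℕ.+-suc ∣ p ∪ q ∣ ∣ p ∩ q ∣)
         (trans (cong suc (∣p∪q∣+∣p∩q∣≡∣p∣+∣q∣ p q)) (sym (ℕ.+-suc ∣ p ∣ ∣ q ∣))))

-- Turns a subset into a vertex set of the form `Fin`, so that it can be part of the intermediate
-- graph in the minimality argument.
enumerate : (p : Subset n) → Fin ∣ p ∣ → Fin n
enumerate (outside ∷ p) i       = suc (enumerate p i)
enumerate (inside  ∷ p) zero    = zero
enumerate (inside  ∷ p) (suc i) = suc (enumerate p i)

enumerate-∈ : ∀ (p : Subset n) i → enumerate p i ∈ p
enumerate-∈ (outside ∷ p) i       = there (enumerate-∈ p i)
enumerate-∈ (inside  ∷ p) zero    = here
enumerate-∈ (inside  ∷ p) (suc i) = there (enumerate-∈ p i)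

enumerate-surjective : ∀ (p : Subset n) {x} → x ∈ p → ∃[ i ] enumerate p i ≡ x
enumerate-surjective (inside  ∷ p) here       = zero , refl
enumerate-surjective (outside ∷ p) (there x∈) with i , eq ← enumerate-surjective p x∈ = i , cong suc eq
enumerate-surjective (inside  ∷ p) (there x∈) with i , eq ← enumerate-surjective p x∈ = suc i , cong suc eq

-- Hall's theorem

related-∈? : {R : REL (Fin m) (Fin n) 0ℓ} → Decidable R → (A : Subset m) →
  Decidable₁ (λ y → ∃[ x ] x ∈ A × R x y)
related-∈? R? A y = any? λ x → (x ∈? A) ×-dec R? x y

image : {R : REL (Fin m) (Fin n) 0ℓ} → Decidable R → Subset m → Subset n
image R? A = comprehension (related-∈? R? A)

HallCondition : {R : REL (Fin m) (Fin n) 0ℓ} → Decidable R → Set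
HallCondition R? = ∀ A → ∣ A ∣ ≤ ∣ image R? A ∣

module _ {R : REL (Fin m) (Fin n) 0ℓ} (R? : Decidable R) where

  ∈-image⁺ : ∀ {A x y} → x ∈ A → R x y → y ∈ image R? A
  ∈-image⁺ {A} x∈A xRy = ∈-comprehension⁺ (related-∈? R? A) (_ , x∈A , xRy)

  ∈-image⁻ : ∀ {A y} → y ∈ image R? A → ∃[ x ] x ∈ A × R x y
  ∈-image⁻ {A} = ∈-comprehension⁻ (related-∈? R? A)

  -- Searching the finitely many subsets makes a failure of Hall's condition yield a concrete
  -- deficient set, which the submodularity count works with.
  hallCondition⊎deficient : HallCondition R? ⊎ ∃[ A ] ∣ image R? A ∣ < ∣ A ∣
  hallCondition⊎deficient with anySubset? (λ A → suc ∣ image R? A ∣ ≤? ∣ A ∣)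
  ... | yes deficient = inj₂ deficient
  ... | no  ¬deficient = inj₁ λ A → ℕ.≮⇒≥ λ lt → ¬deficient (A , lt)

-- Coding a relation as a set of edges makes the deletion of one edge a subset operation and lets
-- strict inclusion drive the induction.
Joins : Subset (m * n) → REL (Fin m) (Fin n) 0ℓ
Joins T x y = combine x y ∈ T

joins? : (T : Subset (m * n)) → Decidable (Joins {m} {n} T)
joins? T x y = combine x y ∈? T

-- Hall's condition for a singleton forces its image to have at least one element.
hallCondition⇒nonempty : {R : REL (Fin m) (Fin n) 0ℓ} (R? : Decidable R) → HallCondition R? → ∀ x → ∃ (R x)
hallCondition⇒nonempty {n = n} R? hall x with any? (R? x)
... | yes xR  = xR
... | no  ¬xR = contradiction
  (ℕ.≤-trans (ℕ.≤-reflexive (sym (∣⁅x⁆∣≡1 x))) (ℕ.≤-trans (hall ⁅ x ⁆) (p⊆q⇒∣p∣≤∣q∣ {q = ⊥} empty)))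
  (subst (λ c → ¬ 1 ≤ c) (sym (∣⊥∣≡0 n)) λ ())
  where
  empty : image R? ⁅ x ⁆ ⊆ ⊥
  empty y∈ with x′ , x′∈ , xRy ← ∈-image⁻ R? y∈ with refl ← x∈⁅y⁆⇒x≡y x x′∈ = contradiction (_ , xRy) ¬xR

-- Two distinct elements with a common sole neighbour would form a deficient set.
hallCondition∧functional⇒matching :
  {R : REL (Fin m) (Fin n) 0ℓ} (R? : Decidable R) → HallCondition R? →
  (∀ {x y z} → R x y → R x z → y ≡ z) →
  ∃[ f ] Injective _≡_ _≡_ f × (∀ x → R x (f x))
hallCondition∧functional⇒matching {m} {n} {R} R? hall functional = f , injective , fR
  where
  f : Fin m → Fin n
  f = proj₁ ∘ hallCondition⇒nonempty R? hall
  fR : ∀ x → R x (f x)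
  fR = proj₂ ∘ hallCondition⇒nonempty R? hall

  injective : Injective _≡_ _≡_ f
  injective {x} {x′} fx≡fx′ = decidable-stable (x ≟ x′) λ x≢x′ → ℕ.<⇒≱ (two x≢x′)
    (ℕ.≤-trans (hall A) (ℕ.≤-trans (p⊆q⇒∣p∣≤∣q∣ one) (ℕ.≤-reflexive (∣⁅x⁆∣≡1 (f x)))))
    where
    A : Subset m
    A = ⁅ x ⁆ ∪ ⁅ x′ ⁆
    one : image R? A ⊆ ⁅ f x ⁆
    one y∈ with z , z∈ , zRy ← ∈-image⁻ R? y∈ with x∈p∪q⁻ ⁅ x ⁆ ⁅ x′ ⁆ z∈
    ... | inj₁ z∈ with refl ← x∈⁅y⁆⇒x≡y x  z∈ = subst (_∈ ⁅ f x ⁆) (functional (fR x) zRy) (x∈⁅x⁆ _)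
    ... | inj₂ z∈ with refl ← x∈⁅y⁆⇒x≡y x′ z∈ =
      subst (_∈ ⁅ f x ⁆) (trans fx≡fx′ (functional (fR x′) zRy)) (x∈⁅x⁆ _)
    two : x ≢ x′ → 1 < ∣ A ∣
    two x≢x′ = subst (_< ∣ A ∣) (∣⁅x⁆∣≡1 x) (p⊂q⇒∣p∣<∣q∣
      (p⊆p∪q ⁅ x′ ⁆ , x′ , q⊆p∪q ⁅ x ⁆ ⁅ x′ ⁆ (x∈⁅x⁆ x′) , λ x′∈ → x≢x′ (sym (x∈⁅y⁆⇒x≡y x x′∈))))

-- Rado's argument: if A₁ and A₂ become deficient when (x , y₁) respectively (x , y₂) is removed, then
-- by submodularity A₁ ∪ A₂ or (A₁ ∩ A₂) - x was deficient already.
redundantEdge : (T : Subset (m * n)) → HallCondition (joins? {m} {n} T) →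
  ∀ {x : Fin m} {y₁ y₂ : Fin n} → Joins T x y₁ → Joins T x y₂ → y₁ ≢ y₂ →
  HallCondition (joins? {m} {n} (T - combine x y₁)) ⊎ HallCondition (joins? {m} {n} (T - combine x y₂))
redundantEdge {m} {n} T hall {x} {y₁} {y₂} xTy₁ xTy₂ y₁≢y₂
  with hallCondition⊎deficient (joins? {m} {n} (T - combine x y₁))
     | hallCondition⊎deficient (joins? {m} {n} (T - combine x y₂))
... | inj₁ hall₁ | _ = inj₁ hall₁
... | _ | inj₁ hall₂ = inj₂ hall₂
... | inj₂ (A₁ , deficient₁) | inj₂ (A₂ , deficient₂) = contradiction overcount ℕ.1+n≰n
  where
  T-xy? : ∀ y → Decidable (Joins {m} {n} (T - combine x y))
  T-xy? y = joins? (T - combine x y)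

  N₁ N₂ : Subset n
  N₁ = image (T-xy? y₁) A₁
  N₂ = image (T-xy? y₂) A₂

  keep : ∀ {y z w} → Joins T z w → ¬ (z ≡ x × w ≡ y) → Joins (T - combine x y) z w
  keep {y} {z} {w} zTw ≢xy = x∈p∧x≢y⇒x∈p-y zTw (≢xy ∘ combine-injective z w x y)

  -- Deleting an edge at `x` leaves the image of a set that misses `x` unchanged, so a set that
  -- becomes deficient must contain `x`.
  x∈deficient : ∀ y B → ∣ image (T-xy? y) B ∣ < ∣ B ∣ → x ∈ B
  x∈deficient y B deficient = decidable-stable (x ∈? B) λ x∉B →
    ℕ.<⇒≱ deficient (ℕ.≤-trans (hall B) (p⊆q⇒∣p∣≤∣q∣ λ w∈ →
      let z , z∈B , zTw = ∈-image⁻ (joins? {m} {n} T) w∈ in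
      ∈-image⁺ (T-xy? y) z∈B (keep zTw λ (z≡x , _) → x∉B (subst (_∈ B) z≡x z∈B))))

  ∪-image : image (joins? {m} {n} T) (A₁ ∪ A₂) ⊆ N₁ ∪ N₂
  -- An edge at `x` survives at least one of the two deletions because `y₁ ≢ y₂`, and `x` lies in
  -- both `A₁` and `A₂`. Edges elsewhere survive both.
  ∪-image {w} w∈ with z , z∈ , zTw ← ∈-image⁻ (joins? {m} {n} T) w∈ with z ≟ x | w ≟ y₁
  ... | yes refl | yes refl = x∈p∪q⁺ (inj₂ (∈-image⁺ (T-xy? y₂) (x∈deficient y₂ A₂ deficient₂)
                                              (keep zTw (y₁≢y₂ ∘ proj₂))))
  ... | yes refl | no w≢y₁  = x∈p∪q⁺ (inj₁ (∈-image⁺ (T-xy? y₁) (x∈deficient y₁ A₁ deficient₁)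
                                              (keep zTw (w≢y₁ ∘ proj₂))))
  ... | no z≢x   | _ with x∈p∪q⁻ A₁ A₂ z∈
  ...   | inj₁ z∈A₁ = x∈p∪q⁺ (inj₁ (∈-image⁺ (T-xy? y₁) z∈A₁ (keep zTw (z≢x ∘ proj₁))))
  ...   | inj₂ z∈A₂ = x∈p∪q⁺ (inj₂ (∈-image⁺ (T-xy? y₂) z∈A₂ (keep zTw (z≢x ∘ proj₁))))

  -- Both deletions affect only edges at `x`, so once `x` is excluded every edge is kept in both.
  ∩-image : image (joins? {m} {n} T) ((A₁ ∩ A₂) - x) ⊆ N₁ ∩ N₂
  ∩-image {w} w∈ = x∈p∩q⁺
    ( ∈-image⁺ (T-xy? y₁) (proj₁ z∈A₁×A₂) (keep zTw (z≢x ∘ proj₁))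
    , ∈-image⁺ (T-xy? y₂) (proj₂ z∈A₁×A₂) (keep zTw (z≢x ∘ proj₁)) )
    where
    preimage = ∈-image⁻ (joins? {m} {n} T) w∈
    z = proj₁ preimage
    zTw = proj₂ (proj₂ preimage)
    z∈A₁×A₂ = x∈p∩q⁻ A₁ A₂ (p─q⊆p (A₁ ∩ A₂) ⁅ x ⁆ (proj₁ (proj₂ preimage)))
    z≢x : z ≢ x
    z≢x z≡x = x∉p-x (A₁ ∩ A₂) x (subst (_∈ (A₁ ∩ A₂) - x) z≡x (proj₁ (proj₂ preimage)))

  overcount : suc (suc (∣ N₁ ∣ + ∣ N₂ ∣)) ≤ suc (∣ N₁ ∣ + ∣ N₂ ∣)
  -- The two strict deficiencies gain 2, whereas removing `x` from the intersection costs only 1.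
  overcount = begin
    suc (suc (∣ N₁ ∣ + ∣ N₂ ∣))              ≡⟨ cong suc (ℕ.+-suc ∣ N₁ ∣ ∣ N₂ ∣) ⟨
    suc ∣ N₁ ∣ + suc ∣ N₂ ∣                  ≤⟨ ℕ.+-mono-≤ deficient₁ deficient₂ ⟩
    ∣ A₁ ∣ + ∣ A₂ ∣                          ≡⟨ ∣p∪q∣+∣p∩q∣≡∣p∣+∣q∣ A₁ A₂ ⟨
    ∣ A₁ ∪ A₂ ∣ + ∣ A₁ ∩ A₂ ∣                ≤⟨ ℕ.+-monoʳ-≤ ∣ A₁ ∪ A₂ ∣ (∣p∣≤1+∣p-x∣ (A₁ ∩ A₂) x) ⟩
    ∣ A₁ ∪ A₂ ∣ + suc ∣ (A₁ ∩ A₂) - x ∣      ≤⟨ ℕ.+-mono-≤ (ℕ.≤-trans (hall _) (p⊆q⇒∣p∣≤∣q∣ ∪-image))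
                                                  (s≤s (ℕ.≤-trans (hall _) (p⊆q⇒∣p∣≤∣q∣ ∩-image))) ⟩
    ∣ N₁ ∪ N₂ ∣ + suc ∣ N₁ ∩ N₂ ∣            ≡⟨ ℕ.+-suc ∣ N₁ ∪ N₂ ∣ ∣ N₁ ∩ N₂ ∣ ⟩
    suc (∣ N₁ ∪ N₂ ∣ + ∣ N₁ ∩ N₂ ∣)          ≡⟨ cong suc (∣p∪q∣+∣p∩q∣≡∣p∣+∣q∣ N₁ N₂) ⟩
    suc (∣ N₁ ∣ + ∣ N₂ ∣)                    ∎
    where open ℕ.≤-Reasoning

-- As long as some vertex has two neighbours, one of these two edges can be deleted; once none has,
-- the relation is functional and is itself a matching.
hallJoins : (T : Subset (m * n)) → Acc _⊂_ T → HallCondition (joins? {m} {n} T) →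
  ∃[ f ] Injective _≡_ _≡_ f × (∀ x → Joins {m} {n} T x (f x))
hallJoins {m} {n} T (acc smaller) hall
  with any? (λ x → any? λ y → any? λ z → joins? {m} {n} T x y ×-dec joins? T x z ×-dec ¬? (y ≟ z))
... | no ¬branching = hallCondition∧functional⇒matching (joins? T) hall λ {x} {y} {z} xTy xTz →
  decidable-stable (y ≟ z) λ y≢z → ¬branching (x , y , z , xTy , xTz , y≢z)
... | yes (x , y , z , xTy , xTz , y≢z) with redundantEdge T hall xTy xTz y≢z
...   | inj₁ hall′ with f , injective , fT ← hallJoins _ (smaller (x∈p⇒p-x⊂p xTy)) hall′ =
  f , injective , p─q⊆p T _ ∘ fT
...   | inj₂ hall′ with f , injective , fT ← hallJoins _ (smaller (x∈p⇒p-x⊂p xTz)) hall′ =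
  f , injective , p─q⊆p T _ ∘ fT

hall : {R : REL (Fin m) (Fin n) 0ℓ} (R? : Decidable R) → HallCondition R? →
  ∃[ f ] Injective _≡_ _≡_ f × (∀ x → R x (f x))
hall {m} {n} {R} R? hallR =
  let f , injective , fT = hallJoins T (⊂-wellFounded T) hallT in f , injective , joins⇒R ∘ fT
  where
  edge? : Decidable₁ (λ e → uncurry R (remQuot {m} n e))
  edge? e = uncurry R? (remQuot {m} n e)
  T : Subset (m * n)
  T = comprehension edge?
  joins⇒R : ∀ {x y} → Joins T x y → R x y
  joins⇒R {x} {y} xTy = subst (uncurry R) (remQuot-combine x y) (∈-comprehension⁻ edge? xTy)
  R⇒joins : ∀ {x y} → R x y → Joins T x y
  R⇒joins {x} {y} xRy = ∈-comprehension⁺ edge? (subst (uncurry R) (sym (remQuot-combine x y)) xRy)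
  hallT : HallCondition (joins? {m} {n} T)
  hallT A = ℕ.≤-trans (hallR A) (p⊆q⇒∣p∣≤∣q∣ λ y∈ →
    let _ , x∈A , xRy = ∈-image⁻ R? y∈ in ∈-image⁺ (joins? {m} {n} T) x∈A (R⇒joins xRy))

-- Injective self-maps of finite sets

-- Two of the first `suc n` iterates coincide, and injectivity strips their common applications of
-- `f`. Starting the iteration at `f x` makes the period `suc d`, hence positive.
injective⇒periodic : {f : Fin n → Fin n} → Injective _≡_ _≡_ f → ∀ x → ∃[ d ] fold (f x) f d ≡ x
injective⇒periodic {n} {f} injective x =
  let i , j , i<j , eq = pigeonhole (ℕ.n<1+n n) (fold x f ∘ toℕ) in cancel (toℕ i) (toℕ j) i<j eq
  where
  shift : ∀ d → fold (f x) f d ≡ f (fold x f d)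
  shift zero    = refl
  shift (suc d) = cong f (shift d)
  cancel : ∀ i j → i < j → fold x f i ≡ fold x f j → ∃[ d ] fold (f x) f d ≡ x
  cancel zero    (suc j) _         eq = j , trans (shift j) (sym eq)
  cancel (suc i) (suc j) (s≤s i<j) eq = cancel i j i<j (injective eq)

-- The property is pushed along the orbit of `f x` until the orbit returns to `x`.
injective-reflects : {f : Fin n → Fin n} → Injective _≡_ _≡_ f → {P : Pred (Fin n) 0ℓ} →
  (∀ {x} → P x → P (f x)) → ∀ {x} → P (f x) → P x
injective-reflects {f = f} injective {P} preserves {x} pfx =
  let d , eq = injective⇒periodic injective x in subst P eq (power d)
  where
  power : ∀ d → P (fold (f x) f d)
  power zero    = pfx
  power (suc d) = preserves (power d)

-- The unary case is applied to `f` acting on both coordinates, with pairs coded as elements of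
-- `Fin (n * n)`.
injective-reflects₂ : {f : Fin n → Fin n} → Injective _≡_ _≡_ f → {E : Rel (Fin n) 0ℓ} →
  (∀ {x y} → E x y → E (f x) (f y)) → ∀ {x y} → E (f x) (f y) → E x y
injective-reflects₂ {n} {f} injective {E} preserves {x} {y} fxEfy =
  subst (uncurry E) (remQuot-combine x y) (injective-reflects f²-injective {P} f²-preserves
    (subst (uncurry E) (sym (trans (cong (λ (a , b) → remQuot n (combine (f a) (f b))) (remQuot-combine x y))
                                   (remQuot-combine (f x) (f y)))) fxEfy))
  where
  P : Pred (Fin (n * n)) 0ℓ
  P e = uncurry E (remQuot n e)
  f² : Fin (n * n) → Fin (n * n)
  f² e = let a , b = remQuot n e in combine (f a) (f b)
  f²-injective : Injective _≡_ _≡_ f²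
  f²-injective {d} {e} eq with combine-injective {n} {n} _ _ _ _ eq
  ... | eq₁ , eq₂ = trans (sym (combine-remQuot {n} n d))
    (trans (cong₂ combine (injective eq₁) (injective eq₂)) (combine-remQuot {n} n e))
  f²-preserves : ∀ {e} → P e → P (f² e)
  f²-preserves p = subst (uncurry E) (sym (remQuot-combine {n} {n} _ _)) (preserves p)

-- Relations between graphs

infixl 8 _⨾_

_⨾_ : {A B : Set} → FullRelation A (Fin m) → FullRelation (Fin m) B → FullRelation A B
P ⨾ Q = record
  { Related    = λ a b → ∃[ i ] Related P a i × Related Q i b
  ; related?   = λ a b → any? λ i → P.related? a i ×-dec Q.related? i b
  ; fullDomain = λ a → let i , ai = P.fullDomain a ; b , ib = Q.fullDomain i in b , i , ai , ib
  ; fullImage  = λ b → let i , ib = Q.fullImage b ; a , ai = P.fullImage i in a , i , ai , ib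
  }
  where
  module P = FullRelation P
  module Q = FullRelation Q

converse : {A B : Set} → FullRelation A B → FullRelation B A
converse R = record
  { Related    = flip (Related R)
  ; related?   = flip R.related?
  ; fullDomain = R.fullImage
  ; fullImage  = R.fullDomain
  }
  where module R = FullRelation R

∗-⨾ : (G : FinGraph k) (P : FullRelation (Fin k) (Fin m)) (Q : FullRelation (Fin m) (Fin n)) →
  G ∗ (P ⨾ Q) ≐ G ∗ P ∗ Q
∗-⨾ G P Q =
  (λ (u , v , uv , (i , ui , ia) , (j , vj , jb)) → i , j , (u , v , uv , ui , vj) , ia , jb) ,
  (λ (i , j , (u , v , uv , ui , vj) , ia , jb) → u , v , uv , (i , ui , ia) , (j , vj , jb))

∗-congˡ : {G H : FinGraph m} (S : FullRelation (Fin m) (Fin n)) → G ≐ H → G ∗ S ≐ H ∗ S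
∗-congˡ S (G⇒H , H⇒G) =
  (λ (u , v , uv , ua , vb) → u , v , G⇒H uv , ua , vb) ,
  (λ (u , v , uv , ua , vb) → u , v , H⇒G uv , ua , vb)

∗-congʳ : (G : FinGraph m) {R S : FullRelation (Fin m) (Fin n)} → Related R ⇔ Related S → G ∗ R ≐ G ∗ S
∗-congʳ G (R⇒S , S⇒R) =
  (λ (u , v , uv , ua , vb) → u , v , uv , R⇒S ua , R⇒S vb) ,
  (λ (u , v , uv , ua , vb) → u , v , uv , S⇒R ua , S⇒R vb)

≐-sym : {V : Set} {G H : Graph V} → G ≐ H → H ≐ G
≐-sym (G⇒H , H⇒G) = H⇒G , G⇒H

≐-trans : {V : Set} {G H K : Graph V} → G ≐ H → H ≐ K → G ≐ K
≐-trans (G⇒H , H⇒G) (H⇒K , K⇒H) = (λ e → H⇒K (G⇒H e)) , (λ e → H⇒G (K⇒H e))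

-- R-cores

-- Minimality in the form used below: `C ∗ P` has `m` vertices and `Q` carries it back to `C`, so it
-- lies in the equivalence class of `C`.
isRCore⇒≤ : {C : FinGraph k} → IsRCore C →
  (P : FullRelation (Fin k) (Fin m)) (Q : FullRelation (Fin m) (Fin k)) → C ∗ (P ⨾ Q) ≐ C → k ≤ m
isRCore⇒≤ {C = C} core P Q fixed =
  core (C ∗ P) ((P , id , id) , (Q , ≐-trans {G = C ∗ P ∗ Q} {C ∗ (P ⨾ Q)} {C}
    (≐-sym {G = C ∗ (P ⨾ Q)} {C ∗ P ∗ Q} (∗-⨾ C P Q)) fixed))

-- T factors through ∁ A ⊎ T(A): send A along T and ∁ A identically, then T(A) identically and ∁ A along T.
isRCore⇒hallCondition : {C : FinGraph k} → IsRCore C → (T : FullRelation (Fin k) (Fin k)) →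
  C ∗ T ≐ C → HallCondition (FullRelation.related? T)
isRCore⇒hallCondition {k} {C} core T fixed A =
  -- The bound from minimality is `k ≤ ∣ ∁ A ∣ + ∣ TA ∣`; writing `k` as `∣ ∁ A ∣ + ∣ A ∣` allows
  -- `∣ ∁ A ∣` to be cancelled.
  ℕ.+-cancelˡ-≤ ∣ ∁ A ∣ _ _ (ℕ.≤-trans (ℕ.≤-reflexive size)
    (isRCore⇒≤ {C = C} core P Q (≐-trans {G = C ∗ (P ⨾ Q)} {C ∗ T} {C} (∗-congʳ C {P ⨾ Q} {T} P⨾Q⇔T) fixed)))
  where
  module T = FullRelation T

  TA : Subset k
  TA = image T.related? A

  size : ∣ ∁ A ∣ + ∣ A ∣ ≡ k
  size = trans (cong (_+ ∣ A ∣) (∣∁p∣≡n∸∣p∣ A)) (ℕ.m∸n+n≡m (∣p∣≤n A))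

  P⊎ : Fin k → Fin ∣ ∁ A ∣ ⊎ Fin ∣ TA ∣ → Set
  P⊎ v (inj₁ i) = v ≡ enumerate (∁ A) i
  P⊎ v (inj₂ j) = v ∈ A × Related T v (enumerate TA j)

  P⊎? : ∀ v s → Dec (P⊎ v s)
  P⊎? v (inj₁ i) = v ≟ enumerate (∁ A) i
  P⊎? v (inj₂ j) = (v ∈? A) ×-dec T.related? v (enumerate TA j)

  Q⊎ : Fin ∣ ∁ A ∣ ⊎ Fin ∣ TA ∣ → Fin k → Set
  Q⊎ (inj₁ i) b = Related T (enumerate (∁ A) i) b
  Q⊎ (inj₂ j) b = enumerate TA j ≡ b

  Q⊎? : ∀ s b → Dec (Q⊎ s b)
  Q⊎? (inj₁ i) b = T.related? (enumerate (∁ A) i) b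
  Q⊎? (inj₂ j) b = enumerate TA j ≟ b

  split : Fin (∣ ∁ A ∣ + ∣ TA ∣) → Fin ∣ ∁ A ∣ ⊎ Fin ∣ TA ∣
  split = splitAt ∣ ∁ A ∣

  split-surjective : ∀ s → ∃[ i ] split i ≡ s
  split-surjective (inj₁ i) = i ↑ˡ ∣ TA ∣ , splitAt-↑ˡ _ i _
  split-surjective (inj₂ j) = ∣ ∁ A ∣ ↑ʳ j , splitAt-↑ʳ _ _ j

  through : ∀ {a b} → Related T a b → ∃[ s ] P⊎ a s × Q⊎ s b
  -- The intermediate vertex is the copy of `b` in `TA` when `a` lies in `A`, and the copy of `a` in
  -- `∁ A` otherwise.
  through {a} {b} ab with a ∈? A
  ... | yes a∈A with j , refl ← enumerate-surjective TA (∈-image⁺ T.related? a∈A ab) =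
    inj₂ j , (a∈A , ab) , refl
  ... | no  a∉A with i , refl ← enumerate-surjective (∁ A) (x∉p⇒x∈∁p a∉A) = inj₁ i , refl , ab

  along : ∀ {a b} s → P⊎ a s → Q⊎ s b → Related T a b
  along (inj₁ i) refl     ib   = ib
  along (inj₂ j) (_ , aj) refl = aj

  P⊎-total : ∀ s → ∃[ v ] P⊎ v s
  P⊎-total (inj₁ i) = _ , refl
  P⊎-total (inj₂ j) = ∈-image⁻ T.related? (enumerate-∈ TA j)

  Q⊎-total : ∀ s → ∃[ b ] Q⊎ s b
  Q⊎-total (inj₁ i) = T.fullDomain _
  Q⊎-total (inj₂ j) = _ , refl

  throughFin : ∀ {a b} → Related T a b → ∃[ i ] P⊎ a (split i) × Q⊎ (split i) b
  throughFin {a} {b} ab with s , as , sb ← through ab with i , refl ← split-surjective s = i , as , sb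

  P : FullRelation (Fin k) (Fin (∣ ∁ A ∣ + ∣ TA ∣))
  P = record
    { Related    = λ v i → P⊎ v (split i)
    ; related?   = λ v i → P⊎? v (split i)
    ; fullDomain = λ v → let i , vi , _ = throughFin (proj₂ (T.fullDomain v)) in i , vi
    ; fullImage  = λ i → P⊎-total (split i)
    }

  Q : FullRelation (Fin (∣ ∁ A ∣ + ∣ TA ∣)) (Fin k)
  Q = record
    { Related    = λ i b → Q⊎ (split i) b
    ; related?   = λ i b → Q⊎? (split i) b
    ; fullDomain = λ i → Q⊎-total (split i)
    ; fullImage  = λ b → let i , _ , ib = throughFin (proj₂ (T.fullImage b)) in i , ib
    }

  P⨾Q⇔T : Related (P ⨾ Q) ⇔ Related T
  P⨾Q⇔T = (λ (i , ai , ib) → along (split i) ai ib) , throughFin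

-- Twins: vertices with the same neighbourhood.

Twins : {V : Set} → Graph V → Rel V 0ℓ
Twins G u v = ∀ w → (Edge G u w → Edge G v w) × (Edge G v w → Edge G u w)

twins? : (G : FinGraph n) → Decidable (Twins G)
twins? G u v = all? λ w →
  (Graph.edge? G u w →-dec Graph.edge? G v w) ×-dec (Graph.edge? G v w →-dec Graph.edge? G u w)

-- Merging u into its twin v leaves the vertices punchIn u i.
isRCore⇒twinFree : {C : FinGraph k} → IsRCore C → ∀ {u v} → Twins C u v → u ≡ v
isRCore⇒twinFree {suc k} {C} core {u} {v} twins = decidable-stable (u ≟ v) λ u≢v →
  ℕ.1+n≰n (isRCore⇒≤ {C = C} core (merge u≢v) (converse (merge u≢v)) (unmerge u≢v , remerge u≢v))
  where
  representative : u ≢ v → ∀ w → ∃[ i ] Twins C w (punchIn u i)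
  representative u≢v w with u ≟ w
  ... | yes refl = punchOut u≢v , subst (Twins C u) (sym (punchIn-punchOut u≢v)) twins
  ... | no  u≢w  = punchOut u≢w , subst (Twins C w) (sym (punchIn-punchOut u≢w)) λ _ → id , id

  merge : u ≢ v → FullRelation (Fin (suc k)) (Fin k)
  merge u≢v = record
    { Related    = λ w i → Twins C w (punchIn u i)
    ; related?   = λ w i → twins? C w (punchIn u i)
    ; fullDomain = representative u≢v
    ; fullImage  = λ i → punchIn u i , λ _ → id , id
    }

  transfer : ∀ {a b c} → Edge C a b → ∃[ i ] Twins C a (punchIn u i) × Twins C c (punchIn u i) → Edge C c b
  transfer {b = b} ab (i , ai , ci) = proj₂ (ci b) (proj₁ (ai b) ab)

  -- `merge` followed by its converse relates only twins, so no edge is created; it also relates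
  -- every vertex to itself, so no edge is lost.
  unmerge : ∀ u≢v {a b} → Edge (C ∗ (merge u≢v ⨾ converse (merge u≢v))) a b → Edge C a b
  unmerge _ (_ , _ , ab , a∼c , b∼d) = Graph.sym C (transfer (Graph.sym C (transfer ab a∼c)) b∼d)

  remerge : ∀ u≢v {a b} → Edge C a b → Edge (C ∗ (merge u≢v ⨾ converse (merge u≢v))) a b
  remerge u≢v {a} {b} ab =
    let i , ai = representative u≢v a ; j , bj = representative u≢v b in
    a , b , ab , (i , ai , ai) , (j , bj , bj)

-- Embedding the R-core as an induced subgraph.

embedding⇒≅induced : (C : FinGraph k) (G : FinGraph n) (f : Fin k → Fin n) → Injective _≡_ _≡_ f →
  (∀ {u v} → Edge C u v → Edge G (f u) (f v)) → (∀ {u v} → Edge G (f u) (f v) → Edge C u v) →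
  Σ[ W ∈ Subset n ] C ≅ induced G W
embedding⇒≅induced {k} {n} C G f injective preserves reflects = W , record
  { vertices = mk↔ₛ′ vertex (proj₁ ∘ preimage)
      (λ w → ∈W-ext (proj₂ (preimage w))) (λ u → injective (proj₂ (preimage (vertex u))))
  ; edges    = λ _ _ → mk⇔ preserves reflects
  }
  where
  inRange? : Decidable₁ (λ w → ∃[ u ] f u ≡ w)
  inRange? w = any? λ u → f u ≟ w

  W : Subset n
  W = comprehension inRange?

  vertex : Fin k → ∃[ v ] v ∈ W
  vertex u = f u , ∈-comprehension⁺ inRange? (u , refl)

  preimage : (w : ∃[ v ] v ∈ W) → ∃[ u ] f u ≡ proj₁ w
  preimage (_ , w∈W) = ∈-comprehension⁻ inRange? w∈W

  -- Vertices of the induced subgraph carry membership proofs; a bijection requires these proofs to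
  -- be unique.
  ∈W-ext : {v w : ∃[ v ] v ∈ W} → proj₁ v ≡ proj₁ w → v ≡ w
  ∈W-ext {v , v∈W} {.v , w∈W} refl = cong (v ,_) ([]=-irrelevant v∈W w∈W)

theorem4p2p11 : ∀ {n k : ℕ} (G : FinGraph n) (C : FinGraph k) → IsRCoreOf C G →
    Σ[ W ∈ Subset n ] C ≅ induced G W
theorem4p2p11 {n} {k} G C (core , (R , C∗R≐G) , (S , G∗S≐C)) =
  embedding⇒≅induced C G f f-injective f-preserves f-reflects
  where
  T : FullRelation (Fin k) (Fin k)
  T = R ⨾ S

  C∗T≐C : C ∗ T ≐ C
  C∗T≐C = ≐-trans {G = C ∗ T} {C ∗ R ∗ S} {C} (∗-⨾ C R S)
    (≐-trans {G = C ∗ R ∗ S} {G ∗ S} {C} (∗-congˡ {G = C ∗ R} {G} S C∗R≐G) G∗S≐C)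

  permutation : ∃[ π ] Injective _≡_ _≡_ π × (∀ u → Related T u (π u))
  permutation = hall (FullRelation.related? T) (isRCore⇒hallCondition {C = C} core T C∗T≐C)

  π : Fin k → Fin k
  π = proj₁ permutation

  f : Fin k → Fin n
  f u = proj₁ (proj₂ (proj₂ permutation) u)

  uRfu : ∀ u → Related R u (f u)
  uRfu u = proj₁ (proj₂ (proj₂ (proj₂ permutation) u))

  fuSπu : ∀ u → Related S (f u) (π u)
  fuSπu u = proj₂ (proj₂ (proj₂ (proj₂ permutation) u))

  f-preserves : ∀ {u v} → Edge C u v → Edge G (f u) (f v)
  f-preserves {u} {v} uv = proj₁ C∗R≐G (u , v , uv , uRfu u , uRfu v)

  π-from-f : ∀ {u v} → Edge G (f u) (f v) → Edge C (π u) (π v)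
  π-from-f {u} {v} fufv = proj₁ G∗S≐C (f u , f v , fufv , fuSπu u , fuSπu v)

  f-reflects : ∀ {u v} → Edge G (f u) (f v) → Edge C u v
  -- Going through `f` shows that `π` preserves edges of `C`; being injective on a finite set, it
  -- also reflects them, which pulls the edge between `π u` and `π v` back to `u` and `v`.
  f-reflects fufv = injective-reflects₂ (proj₁ (proj₂ permutation)) {Edge C} (λ uv → π-from-f (f-preserves uv))
    (π-from-f fufv)

  f-injective : Injective _≡_ _≡_ f
  -- Since `f` preserves and reflects edges, the neighbours of `u` in `C` are determined by `f u`,
  -- so `u` and `v` are twins.
  f-injective {u} {v} fu≡fv = isRCore⇒twinFree {C = C} core λ w →
    (λ uw → f-reflects (subst (λ x → Edge G x (f w)) fu≡fv (f-preserves uw))) ,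
    (λ vw → f-reflects (subst (λ x → Edge G x (f w)) (sym fu≡fv) (f-preserves vw)))
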